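{- Let $p,q$ be primes with $q\equiv 3 \pmod 4$, $p\equiv 1 \pmod q$ and $p\equiv 3\pmod 4$. Let $H$ be the subgroup of squares in $(\mathbb{Z}/q\mathbb{Z})^{*}$, let $$\beta = \frac{1}{q}\sum_{\substack{1\le i\le q-1\\ -i\in H}} i ,$$ and let $a$ be defined by $4p^{h(-q)}=a^2+qb^2$, where $a\equiv 2 \pmod q$ ($a,b$ integers). Then the following two statements are equivalent. (1) The biconditional $$\Bigg[\ \prod_{\substack{1\le k\le (q-1)/2\\ (q+1)/2 -k \equiv 1 \bmod 2}}\Pi_{k}^{(q)}\ \text{ is a quadratic residue modulo } p\ \Bigg]\iff \Bigg[\ \left(\frac{a}{p}\right) = \left(\frac{(-1)^{\beta} \prod_{1\le i\le q-1,\ -i\in H}\left(i\,\frac{p-1}{q}\right)!}{p}\right)\ \Bigg]$$ holds. (2) $$\left(\frac{a}{p}\right) = (-1)^{(q+1)/4}.$$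
   Context: For $k=1,\dots,q$, $\Pi_{k}^{(q)}=\prod_{j=(k-1)(p-1)/q+1}^{k(p-1)/q}j$. The symbol $\left(\frac{\cdot}{p}\right)$ is the Legendre symbol modulo $p$: for an element of $(\mathbb{Z}/p\mathbb{Z})^{*}$ it is $1$ if the element is a quadratic residue modulo $p$ and $-1$ otherwise. $h(-q)$ is the class number of the imaginary quadratic field $\mathbb{Q}(\sqrt{ -q})$. The condition "$-i\in H$" means that the class of $-i$ modulo $q$ lies in $H$.
   Formalization: β is required to be an integer, which excludes q=3 (there β=2/3 and (-1)^β is undefined), and p∤a is assumed, as for h(-q)≥3 some solutions a are divisible by p (q=23, p=599, a=48p, b=2p) and (a/p) is then undefined. -}

module Defs where

open import Data.Bool.Base using (if_then_else_)
open import Data.Fin.Base using (Fin; toℕ)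
open import Data.Fin.Properties using (any?)
open import Data.Integer.Base as ℤ using (ℤ; +_; 0ℤ; 1ℤ; -1ℤ)
open import Data.Integer.Divisibility.Signed using (_∣_; _∣?_)
open import Data.List.Base using (List; []; _∷_; map; filter; upTo)
open import Data.List.Relation.Unary.Any using (Any)
open import Data.Nat.Base as ℕ using (ℕ; suc; _∸_; NonZero)
open import Data.Nat.DivMod using (_/_; _%_)
open import Data.Nat.ListAction using (product)
open import Data.Nat.Properties using () renaming (_≟_ to _≟ℕ_)
open import Data.Product.Base using (Σ; ∃; _×_)
open import Data.Rational.Base as ℚ using (ℚ; 0ℚ; 1ℚ)
open import Function.Bundles using (_⇔_)
open import Function.Definitions using (Bijective)
open import Relation.Binary.PropositionalEquality.Core using (_≡_; _≢_)
open import Relation.Nullary.Decidable using (Dec; does; ¬?; _×-dec_)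
open import Relation.Nullary.Negation using (¬_)

-- The integers m, m + 1, …, n (empty if n < m).
[_⋯_] : ℕ → ℕ → List ℕ
[ m ⋯ n ] = map (m ℕ.+_) (upTo (suc n ∸ m))

-- For n prime: the class of a is a unit of ℤ/nℤ and a square; x runs over
-- representatives of the residue classes modulo n.
QuadraticResidue : ℕ → ℤ → Set
QuadraticResidue n a =
  ¬ (+ n ∣ a) × ∃ λ (x : Fin n) → + n ∣ (+ toℕ x) ℤ.* (+ toℕ x) ℤ.- a

quadraticResidue? : ∀ n a → Dec (QuadraticResidue n a)
quadraticResidue? n a =
  ¬? (+ n ∣? a) ×-dec
  any? (λ x → + n ∣? (+ toℕ x) ℤ.* (+ toℕ x) ℤ.- a)

legendre : ℕ → ℤ → ℤ
legendre p a =
  if does (+ p ∣? a) then 0ℤ else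
  if does (quadraticResidue? p a) then 1ℤ else -1ℤ

-- Π[ p , q ] k is the product of the k-th of the q consecutive blocks of
-- length (p - 1)/q into which 1, …, p - 1 is cut; the division is exact when
-- p ≡ 1 modulo q, and k is meant to be at least 1.
Π[_,_] : (p q : ℕ) .{{_ : NonZero q}} → ℕ → ℕ
Π[ p , q ] k = product [ (k ∸ 1) ℕ.* N ℕ.+ 1 ⋯ k ℕ.* N ]
  where
  N : ℕ
  N = (p ∸ 1) / q

-- For k ≤ (q - 1)/2 the subtraction (q + 1)/2 ∸ k does not truncate.
oddGapIndices : ℕ → List ℕ
oddGapIndices q =
  filter (λ k → ((q ℕ.+ 1) / 2 ∸ k) % 2 ≟ℕ 1) [ 1 ⋯ (q ∸ 1) / 2 ]

-- The i with 1 ≤ i ≤ q - 1 and -i ∈ H, where H is the group of squares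
-- in (ℤ/qℤ)*.
negSquares : ℕ → List ℕ
negSquares q = filter (λ i → quadraticResidue? q (ℤ.- (+ i))) [ 1 ⋯ q ∸ 1 ]

-- For d > 0, the imaginary quadratic field ℚ(√-d), where x +√-d y stands for
-- x + y √-d.
module ImaginaryQuadratic (d : ℕ) where

  infix  5 _+√-d_
  infixl 6 _+_
  infixl 7 _*_

  record K : Set where
    constructor _+√-d_
    field
      re im : ℚ

  0K 1K : K
  0K = 0ℚ +√-d 0ℚ
  1K = 1ℚ +√-d 0ℚ

  fromℤ : ℤ → K
  fromℤ n = (n ℚ./ 1) +√-d 0ℚ

  _+_ _*_ : K → K → K
  (x +√-d y) + (u +√-d v) = (x ℚ.+ u) +√-d (y ℚ.+ v)
  (x +√-d y) * (u +√-d v) =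
    (x ℚ.* u ℚ.- (+ d ℚ./ 1) ℚ.* (y ℚ.* v)) +√-d (x ℚ.* v ℚ.+ y ℚ.* u)

  -- The value at α of the monic polynomial with lower coefficients
  -- c₀ ∷ … ∷ cₙ₋₁ ∷ [], that is c₀ + c₁ α + … + cₙ₋₁ αⁿ⁻¹ + αⁿ.
  evalMonic : List ℤ → K → K
  evalMonic []       α = 1K
  evalMonic (c ∷ cs) α = fromℤ c + α * evalMonic cs α

  -- Membership in the ring of integers.
  Integral : K → Set
  Integral α = ∃ λ cs → evalMonic cs α ≡ 0K

  -- x ∈Span gs : x is a combination of gs with coefficients in the ring of
  -- integers.
  infix 4 _∈Span_
  _∈Span_ : K → List K → Set
  x ∈Span []       = x ≡ 0K
  x ∈Span (g ∷ gs) =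
    ∃ λ c → ∃ λ y → Integral c × y ∈Span gs × x ≡ c * g + y

  -- A fractional ideal is a nonzero finitely generated submodule of K over
  -- the ring of integers, given here by a list of generators. Distinct lists
  -- may present the same ideal; _∼_ only depends on the spans.
  record FractionalIdeal : Set where
    field
      generators : List K
      nonzero    : Any (_≢ 0K) generators
  open FractionalIdeal

  -- I ∼ J : α I = J for some α in K*, that is, I and J lie in the same ideal
  -- class.
  infix 4 _∼_
  _∼_ : FractionalIdeal → FractionalIdeal → Set
  I ∼ J = ∃ λ α → α ≢ 0K ×
    (∀ x → x ∈Span map (α *_) (generators I) ⇔ x ∈Span generators J)

-- h is the class number of ℚ(√-d): the fractional ideals modulo _∼_ are in
-- bijection with Fin h.
IsClassNumber : (d h : ℕ) → Set
IsClassNumber d h = Σ (Fin h → FractionalIdeal) (Bijective _≡_ _∼_)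
  where open ImaginaryQuadratic d

module Submission where

-- Write N = (p - 1)/q, m = (q - 1)/2, and write the quadratic characters modulo
-- p and q additively, with values in ℤ/2. As p, q ≡ 3 (mod 4), both change by 1
-- under x ↦ -x. Let Γ i be the character of (i N)! modulo p and σ i that of i
-- modulo q, so that -i ∈ H iff σ i = 1. The product of all 1 ≤ x < p has
-- character 1 and N is even, so Γ (q - i) = Γ i + 1; also σ (q - i) = σ i + 1,
-- and (q - i) ≡ i + 1 (mod 2). Since q β is the sum of the i with σ i = 1, the
-- product F = (-1)^β ∏ (i N)! has character
--   ∑_{1 ≤ i < q} σ i (i + Γ i) = ∑_{1 ≤ i ≤ m} (i + Γ i),
-- where ∑_{1 ≤ i ≤ m} i ≡ (q + 1)/4 (mod 2). The character of Π_k is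
-- Γ k + Γ (k - 1), and the k with (q + 1)/2 - k odd are the odd k ≤ m, so the
-- product of these Π_k has character ∑_{1 ≤ i ≤ m} Γ i. This is the character of
-- F plus (q + 1)/4, and the equivalence follows by comparison with that of a.

-- Fermat's little theorem by the binomial theorem.

module Fermat where
  open import Data.Nat.Base
  open import Data.Nat.Properties
  open import Data.Nat.Divisibility
  open import Data.Nat.DivMod using (m/n*n≡m)
  open import Data.Nat.Primality using (Prime; euclidsLemma; ¬prime[0]; ¬prime[1])
  open import Data.Nat.Combinatorics
  open import Data.Fin.Base using (Fin; toℕ; fromℕ; inject₁) renaming (zero to fzero; suc to fsuc)
  open import Data.Fin.Properties using (toℕ-fromℕ; toℕ-inject₁; toℕ<n)
  open import Data.Sum.Base using (inj₁; inj₂)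
  open import Data.Product.Base using (∃; _×_; _,_)
  open import Function.Base using (_∘_)
  open import Relation.Binary.PropositionalEquality
  open import Relation.Nullary using (contradiction)
  open import Algebra.Properties.CommutativeSemiring.Binomial +-*-commutativeSemiring using (binomialTerm; theorem)
  open import Algebra.Properties.Semiring.Sum +-*-semiring using (sum-init-last) renaming (sum to ∑ᶠ)
  open import Algebra.Properties.Semiring.Mult +-*-semiring using () renaming (_×_ to _·_)
  import Algebra.Properties.Semiring.Exp +-*-semiring as Exp

  ·≡* : ∀ n x → n · x ≡ n * x
  ·≡* zero    x = refl
  ·≡* (suc n) x = cong (x +_) (·≡* n x)

  Exp≡^ : ∀ x n → x Exp.^ n ≡ x ^ n
  Exp≡^ x zero    = refl
  Exp≡^ x (suc n) = cong (x *_) (Exp≡^ x n)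

  ∣-∑ᶠ : ∀ {d n} (f : Fin n → ℕ) → (∀ i → d ∣ f i) → d ∣ ∑ᶠ f
  ∣-∑ᶠ {d} {zero}  f d∣f = d ∣0
  ∣-∑ᶠ {d} {suc n} f d∣f = ∣m∣n⇒∣m+n (d∣f fzero) (∣-∑ᶠ (f ∘ fsuc) (d∣f ∘ fsuc))

  prime∤! : ∀ {p} → Prime p → ∀ {n} → n < p → p ∤ n !
  prime∤! pp {zero}  _   p∣1 = ¬prime[1] (subst Prime (∣1⇒≡1 p∣1) pp)
  prime∤! pp {suc n} n<p p∣! with euclidsLemma (suc n) (n !) pp p∣!
  ... | inj₁ p∣n  = <⇒≱ n<p (∣⇒≤ p∣n)
  ... | inj₂ p∣n! = prime∤! pp (<-trans (n<1+n n) n<p) p∣n!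

  -- The prime divides p! = C(p,k) k! (p - k)! but neither of the two factorials, since both are of
  -- numbers below p.
  prime∣C : ∀ {p k} → Prime p → 0 < k → k < p → p ∣ p C k
  prime∣C {p@(suc p-1)} {k@(suc k-1)} pp 0<k k<p with euclidsLemma (p C k) (k ! * (p ∸ k) !) pp p∣
    where
    instance _ = k !* (p ∸ k) !≢0
    p∣ : p ∣ (p C k) * (k ! * (p ∸ k) !)
    p∣ = subst (p ∣_)
      (sym (trans (cong (_* (k ! * (p ∸ k) !)) (nCk≡n!/k![n-k]! (<⇒≤ k<p))) (m/n*n≡m (k![n∸k]!∣n! (<⇒≤ k<p)))))
      (m∣m*n (p-1 !))
  ... | inj₁ p∣C = p∣C
  ... | inj₂ p∣k! with euclidsLemma (k !) ((p ∸ k) !) pp p∣k!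
  ...   | inj₁ bad = contradiction bad (prime∤! pp k<p)
  ...   | inj₂ bad = contradiction bad (prime∤! pp (s≤s (m∸n≤m p-1 k-1)))

  -- The binomial expansion with its two end terms split off: p divides every middle coefficient.
  -- The multiple c of p is named so that no subtraction in ℕ is needed.
  freshman : ∀ {p} → Prime p → ∀ x → ∃ λ c → p ∣ c × (x + 1) ^ p ≡ 1 + (c + x ^ p)
  freshman {zero} pp = contradiction pp ¬prime[0]
  freshman {p@(suc p-1)} pp x = ∑ᶠ mid , ∣-∑ᶠ mid p∣mid , eq
    where
    t : Fin (suc p) → ℕ
    t = binomialTerm x 1 p
    -- The index `fsuc (inject₁ i)` runs through the exponents 1 to p - 1, leaving out both 0 and p.
    mid : Fin p-1 → ℕ
    mid i = t (fsuc (inject₁ i))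
    term≡ : ∀ i → t i ≡ (p C toℕ i) * x ^ toℕ i
    term≡ i = trans (·≡* (p C toℕ i) _) (cong ((p C toℕ i) *_)
      (trans (cong₂ _*_ (Exp≡^ x (toℕ i)) (trans (Exp≡^ 1 (p ∸ toℕ i)) (^-zeroˡ (p ∸ toℕ i)))) (*-identityʳ _)))
    p∣mid : ∀ i → p ∣ mid i
    p∣mid i = subst (p ∣_) (sym (term≡ (fsuc (inject₁ i))))
      (∣m⇒∣m*n _ (prime∣C pp (s≤s z≤n) (s≤s (subst (_< p-1) (sym (toℕ-inject₁ i)) (toℕ<n i)))))
    first : t fzero ≡ 1
    first = trans (term≡ fzero) (trans (*-identityʳ _) (trans (nCk≡nC[n∸k] {0} {p} z≤n) (nCn≡1 p)))
    final : t (fromℕ p) ≡ x ^ p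
    final = trans (term≡ (fromℕ p)) (trans (cong (λ k → (p C k) * x ^ k) (toℕ-fromℕ p))
      (trans (cong (_* x ^ p) (nCn≡1 p)) (*-identityˡ _)))
    eq : (x + 1) ^ p ≡ 1 + (∑ᶠ mid + x ^ p)
    eq = begin
      (x + 1) ^ p                         ≡⟨ Exp≡^ (x + 1) p ⟨
      (x + 1) Exp.^ p                     ≡⟨ theorem p x 1 ⟩
      t fzero + ∑ᶠ (t ∘ fsuc)             ≡⟨ cong₂ _+_ first (sum-init-last (t ∘ fsuc)) ⟩
      1 + (∑ᶠ mid + t (fromℕ p))          ≡⟨ cong (λ y → 1 + (∑ᶠ mid + y)) final ⟩
      1 + (∑ᶠ mid + x ^ p)                ∎
      where open ≡-Reasoning

  fermat : ∀ {p} → Prime p → ∀ x → ∃ λ c → p ∣ c × x ^ p ≡ c + x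
  fermat {zero} pp = contradiction pp ¬prime[0]
  fermat {p@(suc _)} pp zero = 0 , p ∣0 , refl
  fermat {p} pp (suc x) with freshman pp x | fermat pp x
  ... | c , p∣c , eq | d , p∣d , eq′ = c + d , ∣m∣n⇒∣m+n p∣c p∣d , (begin
    suc x ^ p             ≡⟨ cong (_^ p) (+-comm 1 x) ⟩
    (x + 1) ^ p           ≡⟨ eq ⟩
    1 + (c + x ^ p)       ≡⟨ cong (λ y → 1 + (c + y)) eq′ ⟩
    1 + (c + (d + x))     ≡⟨ cong suc (+-assoc c d x) ⟨
    1 + (c + d + x)       ≡⟨ +-suc (c + d) x ⟨
    c + d + suc x         ∎)
    where open ≡-Reasoning

-- Squares modulo a prime.

module SquaresModulo where
  open import Data.Fin.Base using (toℕ; fromℕ<)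
  open import Data.Fin.Properties using (toℕ-fromℕ<)
  open import Data.Nat.Base as ℕ using (ℕ; zero; suc; NonZero)
  import Data.Nat.Divisibility as ℕ
  import Data.Nat.Properties as ℕ
  open import Data.Nat.DivMod using (m≡m%n+[m/n]*n)
  open import Data.Nat.Primality
  open import Data.Nat.Tactic.RingSolver using () renaming (solve-∀ to solve-∀ℕ)
  open import Data.Integer.Base hiding (NonZero; suc) renaming (∣_∣ to abs)
  open import Data.Integer.DivMod using (_%ℕ_; _/ℕ_; n%ℕd<d; a≡a%ℕn+[a/ℕn]*n)
  open import Data.Integer.Divisibility.Signed
  open import Data.Integer.Properties
  open import Data.Integer.Tactic.RingSolver using (solve-∀)
  open import Data.Product.Base using (_,_)
  open import Data.Sum.Base as Sum using (_⊎_; inj₁; inj₂; [_,_]′)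
  open import Function.Base using (_∘_)
  open import Relation.Binary.PropositionalEquality
  open import Relation.Nullary using (¬_; contradiction)
  open import Defs
  open Fermat

  euclidsLemmaℤ : ∀ {p} → Prime p → ∀ a b → + p ∣ a * b → + p ∣ a ⊎ + p ∣ b
  euclidsLemmaℤ pp a b p∣ab = Sum.map ∣ᵤ⇒∣ ∣ᵤ⇒∣
    (euclidsLemma (abs a) (abs b) pp (subst (_ ℕ.∣_) (abs-* a b) (∣⇒∣ᵤ p∣ab)))

  ∤-* : ∀ {p} → Prime p → ∀ {a b} → ¬ + p ∣ a → ¬ + p ∣ b → ¬ + p ∣ a * b
  ∤-* pp {a} {b} p∤a p∤b p∣ab with euclidsLemmaℤ pp a b p∣ab
  ... | inj₁ p∣a = p∤a p∣a
  ... | inj₂ p∣b = p∤b p∣b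

  ∤-neg : ∀ {n a} → ¬ n ∣ a → ¬ n ∣ - a
  ∤-neg {n} {a} n∤a n∣-a = n∤a (subst (n ∣_) (neg-involutive a) (∣m⇒∣-m n∣-a))

  ∣-cong : ∀ {n a b} → n ∣ a - b → n ∣ a → n ∣ b
  ∣-cong {n} {a} {b} n∣a-b n∣a = subst (n ∣_) (identity a b) (∣m∣n⇒∣m-n n∣a n∣a-b)
    where
    identity : ∀ a b → a - (a - b) ≡ b
    identity = solve-∀

  ∣-sym : ∀ {n} a b → n ∣ a - b → n ∣ b - a
  ∣-sym {n} a b n∣a-b = subst (n ∣_) (identity a b) (∣m⇒∣-m n∣a-b)
    where
    identity : ∀ a b → - (a - b) ≡ b - a
    identity = solve-∀

  ∣-%ℕ : ∀ n .{{_ : NonZero n}} a → + n ∣ a - + (a %ℕ n)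
  ∣-%ℕ n a = divides (a /ℕ n) (trans (cong (_- r) (a≡a%ℕn+[a/ℕn]*n a n)) (identity r (a /ℕ n * + n)))
    where
    r = + (a %ℕ n)
    identity : ∀ r k → r + k - r ≡ k
    identity = solve-∀

  -- `QuadraticResidue` wants a root in `Fin n`, so x is replaced by its remainder r; the error is
  -- x² - r² = (x - r)(x + r).
  square⇒residue : ∀ {n} .{{_ : NonZero n}} {a} x → ¬ + n ∣ a → + n ∣ x * x - a → QuadraticResidue n a
  square⇒residue {n} {a} x n∤a n∣ = n∤a , fromℕ< r<n ,
    subst (λ r → + n ∣ + r * + r - a) (sym (toℕ-fromℕ< r<n))
      (subst (+ n ∣_) (identity x (+ (x %ℕ n)) a) (∣m∣n⇒∣m-n n∣ (∣m⇒∣m*n (x + + (x %ℕ n)) (∣-%ℕ n x))))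
    where
    r<n = n%ℕd<d x n
    identity : ∀ x r a → x * x - a - (x - r) * (x + r) ≡ r * r - a
    identity = solve-∀

  residue-cong : ∀ {n} {a b} → + n ∣ a - b → QuadraticResidue n a → QuadraticResidue n b
  residue-cong {n} {a} {b} n∣a-b (n∤a , x , n∣) =
    n∤a ∘ ∣-cong (∣-sym a b n∣a-b) , x ,
    subst (+ n ∣_) (identity (+ toℕ x) a b) (∣m∣n⇒∣m+n n∣ n∣a-b)
    where
    identity : ∀ x a b → x * x - a + (a - b) ≡ x * x - b
    identity = solve-∀

  residue-* : ∀ {n} → Prime n → ∀ {a b} → QuadraticResidue n a → QuadraticResidue n b → QuadraticResidue n (a * b)
  residue-* {n} pn {a} {b} (n∤a , x , n∣x²-a) (n∤b , y , n∣y²-b) =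
    square⇒residue {{prime⇒nonZero pn}} (+ toℕ x * + toℕ y) (∤-* pn n∤a n∤b)
      (subst (+ n ∣_) (identity (+ toℕ x) (+ toℕ y) a b)
        (∣m∣n⇒∣m+n (∣m⇒∣m*n (+ toℕ y * + toℕ y) n∣x²-a) (∣n⇒∣m*n a n∣y²-b)))
    where
    identity : ∀ x y a b → (x * x - a) * (y * y) + a * (y * y - b) ≡ x * y * (x * y) - a * b
    identity = solve-∀

  residue-1 : ∀ {n} → Prime n → QuadraticResidue n 1ℤ
  residue-1 {n} pn = square⇒residue 1ℤ (prime∤! pn {0} (ℕ.>-nonZero⁻¹ n) ∘ ∣⇒∣ᵤ) (divides 0ℤ refl)
    where instance _ = prime⇒nonZero pn

  [x*x]^k≡x^k*x^k : ∀ x k → (x ℕ.* x) ℕ.^ k ≡ x ℕ.^ k ℕ.* x ℕ.^ k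
  [x*x]^k≡x^k*x^k x zero    = refl
  [x*x]^k≡x^k*x^k x (suc k) = trans (cong (x ℕ.* x ℕ.*_) ([x*x]^k≡x^k*x^k x k)) (identity x (x ℕ.^ k))
    where
    identity : ∀ x y → x ℕ.* x ℕ.* (y ℕ.* y) ≡ x ℕ.* y ℕ.* (x ℕ.* y)
    identity = solve-∀ℕ

  -- Induction from exponent j to j + 2 through (x + y)(x^(j+1) + y^(j+1)) = xy (x^j + y^j) +
  -- (x^(j+2) + y^(j+2)).
  ∣sum-odd-powers : ∀ {d} x y → d ℕ.∣ x ℕ.+ y → ∀ k → d ℕ.∣ x ℕ.^ suc (k ℕ.* 2) ℕ.+ y ℕ.^ suc (k ℕ.* 2)
  ∣sum-odd-powers {d} x y d∣ zero = subst (d ℕ.∣_) (sym (cong₂ ℕ._+_ (ℕ.*-identityʳ x) (ℕ.*-identityʳ y))) d∣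
  ∣sum-odd-powers {d} x y d∣ (suc k) =
    ℕ.∣m+n∣m⇒∣n (subst (d ℕ.∣_) (identity x y (x ℕ.^ suc (k ℕ.* 2)) (y ℕ.^ suc (k ℕ.* 2)))
       (ℕ.∣m⇒∣m*n (x ℕ.* x ℕ.^ suc (k ℕ.* 2) ℕ.+ y ℕ.* y ℕ.^ suc (k ℕ.* 2)) d∣))
     (ℕ.∣n⇒∣m*n (x ℕ.* y) (∣sum-odd-powers x y d∣ k))
    where
    identity : ∀ x y u v → (x ℕ.+ y) ℕ.* (x ℕ.* u ℕ.+ y ℕ.* v) ≡
      x ℕ.* y ℕ.* (u ℕ.+ v) ℕ.+ (x ℕ.* (x ℕ.* u) ℕ.+ y ℕ.* (y ℕ.* v))
    identity = solve-∀ℕ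

  -- Primes congruent to 3 modulo 4: exactly one of a and -a is a square.

  module ThreeModFour {n : ℕ} (pn : Prime n) (n%4≡3 : n ℕ.% 4 ≡ 3) where

    private instance
      n≢0 : NonZero n
      n≢0 = prime⇒nonZero pn

    -- With n = 4t + 3 this m is (n - 1)/2, written as 2t + 1 so that its oddness is visible.
    t m : ℕ
    t = n ℕ./ 4
    m = suc (t ℕ.* 2)

    n≡1+m+m : n ≡ suc (m ℕ.+ m)
    n≡1+m+m = trans (m≡m%n+[m/n]*n n 4) (trans (cong (ℕ._+ t ℕ.* 4) n%4≡3) (identity t))
      where
      identity : ∀ t → 3 ℕ.+ t ℕ.* 4 ≡ suc (suc (t ℕ.* 2) ℕ.+ suc (t ℕ.* 2))
      identity = solve-∀ℕ

    -- Fermat's r^n - r, with n = 2m + 1, factored as r((r^m)² - 1), so that Euclid's lemma yields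
    -- r^m ≡ ±1 when n does not divide r.
    fermat-m : ∀ r → + n ∣ + r * (+ (r ℕ.^ m) - 1ℤ) * (+ (r ℕ.^ m) + 1ℤ)
    fermat-m r with fermat pn r
    ... | c , n∣c , rⁿ≡c+r = subst (+ n ∣_) c≡ (∣ᵤ⇒∣ n∣c)
      where
      open ≡-Reasoning
      u = r ℕ.^ m
      identity₁ : ∀ r c → c ≡ (c + r) - r
      identity₁ = solve-∀
      identity₂ : ∀ r u → r * (u * u) - r ≡ r * (u - 1ℤ) * (u + 1ℤ)
      identity₂ = solve-∀
      c≡ : + c ≡ + r * (+ u - 1ℤ) * (+ u + 1ℤ)
      c≡ = begin
        + c                               ≡⟨ identity₁ (+ r) (+ c) ⟩
        + (c ℕ.+ r) - + r                 ≡⟨ cong (λ y → + y - + r) (sym rⁿ≡c+r) ⟩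
        + (r ℕ.^ n) - + r                 ≡⟨ cong (λ k → + (r ℕ.^ k) - + r) n≡1+m+m ⟩
        + (r ℕ.* r ℕ.^ (m ℕ.+ m)) - + r   ≡⟨ cong (λ y → + (r ℕ.* y) - + r) (ℕ.^-distribˡ-+-* r m m) ⟩
        + (r ℕ.* (u ℕ.* u)) - + r         ≡⟨ cong (_- + r) (trans (pos-* r (u ℕ.* u)) (cong (+ r *_) (pos-* u u))) ⟩
        + r * (+ u * + u) - + r           ≡⟨ identity₂ (+ r) (+ u) ⟩
        + r * (+ u - 1ℤ) * (+ u + 1ℤ)     ∎

    -- Fermat gives a ^ m ≡ ±1 for m = (n - 1)/2, so ±a ≡ a ^ (m + 1), and
    -- m + 1 = 2 (t + 1) is even.
    residue⊎residue-neg : ∀ a → ¬ + n ∣ a → QuadraticResidue n a ⊎ QuadraticResidue n (- a)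
    residue⊎residue-neg a n∤a = Sum.map
      (λ n∣ → residue-cong (∣-sym a (+ r) r≡a) (square⇒residue v n∤r
         (subst (+ n ∣_) (trans (id₁ (+ r) u) (cong (_- + r) ru≡v²)) n∣)))
      (λ n∣ → residue-cong (subst (+ n ∣_) (id₃ a (+ r)) r≡a) (square⇒residue v (∤-neg n∤r)
         (subst (+ n ∣_) (trans (id₂ (+ r) u) (cong (_- - + r) ru≡v²)) (∣n⇒∣m*n (+ r) n∣))))
      (euclidsLemmaℤ pn (+ r * (u - 1ℤ)) (u + 1ℤ) (fermat-m r))
      where
      r = a %ℕ n
      u v : ℤ
      u = + (r ℕ.^ m)
      v = + (r ℕ.^ suc t)
      r≡a : + n ∣ a - + r
      r≡a = ∣-%ℕ n a
      n∤r : ¬ + n ∣ + r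
      n∤r = n∤a ∘ ∣-cong (∣-sym a (+ r) r≡a)
      ru≡v² : + r * u ≡ v * v
      ru≡v² = trans (sym (pos-* r (r ℕ.^ m)))
        (trans (cong +_ (trans (cong (r ℕ.^_) (exponent t)) (ℕ.^-distribˡ-+-* r (suc t) (suc t))))
          (pos-* (r ℕ.^ suc t) (r ℕ.^ suc t)))
        where
        exponent : ∀ t → suc (suc (t ℕ.* 2)) ≡ suc t ℕ.+ suc t
        exponent = solve-∀ℕ
      id₁ : ∀ r u → r * (u - 1ℤ) ≡ r * u - r
      id₁ = solve-∀
      id₂ : ∀ r u → r * (u + 1ℤ) ≡ r * u - - r
      id₂ = solve-∀
      id₃ : ∀ a r → a - r ≡ - r - - a
      id₃ = solve-∀

    -- Here (x²)^m = x^(n - 1); cancelling the factor x in Fermat's theorem leaves (x^m)² - 1.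
    square^m≡1 : ∀ x → ¬ + n ∣ + x → + n ∣ + ((x ℕ.* x) ℕ.^ m) - 1ℤ
    square^m≡1 x n∤x = [ (λ n∣x → contradiction n∣x n∤x) , subst (+ n ∣_) eq ]′
      (euclidsLemmaℤ pn (+ x) ((+ u - 1ℤ) * (+ u + 1ℤ))
        (subst (+ n ∣_) (*-assoc (+ x) (+ u - 1ℤ) (+ u + 1ℤ)) (fermat-m x)))
      where
      u = x ℕ.^ m
      identity : ∀ u → (u - 1ℤ) * (u + 1ℤ) ≡ u * u - 1ℤ
      identity = solve-∀
      eq : (+ u - 1ℤ) * (+ u + 1ℤ) ≡ + ((x ℕ.* x) ℕ.^ m) - 1ℤ
      eq = trans (identity (+ u)) (cong (_- 1ℤ) (trans (sym (pos-* u u)) (cong +_ (sym ([x*x]^k≡x^k*x^k x m)))))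

    ∤root : ∀ {a} x → ¬ + n ∣ a → + n ∣ x * x - a → ¬ + n ∣ x
    ∤root x n∤a n∣ n∣x = n∤a (∣-cong n∣ (∣m⇒∣m*n x n∣x))

    -- If x² ≡ a and y² ≡ -a, then n divides x² + y², hence x^(2m) + y^(2m) as m
    -- is odd, and this is 1 + 1 by Fermat.
    ¬residue×residue-neg : ∀ a → QuadraticResidue n a → ¬ QuadraticResidue n (- a)
    ¬residue×residue-neg a (n∤a , i , n∣x²-a) (n∤-a , j , n∣y²+a) =
      ℕ.<⇒≱ 2<n (ℕ.∣⇒≤ (∣⇒∣ᵤ (subst (+ n ∣_) (id₂ (+ X) (+ Y))
        (∣m∣n⇒∣m-n
          (∣m∣n⇒∣m-n (∣ᵤ⇒∣ {+ n} {+ (X ℕ.+ Y)} n∣X+Y) (square^m≡1 x (∤root (+ x) n∤a n∣x²-a)))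
          (square^m≡1 y (∤root (+ y) n∤-a n∣y²+a))))))
      where
      x = toℕ i
      y = toℕ j
      X = (x ℕ.* x) ℕ.^ m
      Y = (y ℕ.* y) ℕ.^ m
      2<n : 2 ℕ.< n
      2<n = subst (2 ℕ.<_) (sym n≡1+m+m) (ℕ.s≤s (ℕ.s≤s (ℕ.≤-trans (ℕ.s≤s ℕ.z≤n) (ℕ.m≤n+m m (t ℕ.* 2)))))
      id₁ : ∀ x y a → (x * x - a) + (y * y - - a) ≡ x * x + y * y
      id₁ = solve-∀
      id₂ : ∀ X Y → X + Y - (X - 1ℤ) - (Y - 1ℤ) ≡ + 2
      id₂ = solve-∀
      n∣X+Y : n ℕ.∣ X ℕ.+ Y
      n∣X+Y = ∣sum-odd-powers (x ℕ.* x) (y ℕ.* y) (∣⇒∣ᵤ (subst (+ n ∣_)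
        (trans (id₁ (+ x) (+ y) a) (sym (cong₂ _+_ (pos-* x x) (pos-* y y)))) (∣m∣n⇒∣m+n n∣x²-a n∣y²+a))) t

-- The quadratic character with values in ℤ/2.

module QuadraticCharacter where
  open import Data.Bool.Base using (if_then_else_)
  open import Data.Bool.Properties using (if-float)
  open import Data.Nat.Base as ℕ using (ℕ)
  open import Data.Nat.ListAction using (product)
  open import Data.Nat.Primality
  open import Data.Integer.Base
  open import Data.Integer.Divisibility.Signed
  open import Data.Integer.Properties
  open import Data.Integer.Tactic.RingSolver using (solve-∀)
  open import Data.List.Base using ([]; _∷_; foldr)
  open import Data.List.Relation.Unary.All using (All; []; _∷_)
  open import Data.Parity.Base as ℙ using (Parity; 0ℙ; 1ℙ; _⁻¹)
  open import Data.Product.Base using (proj₁)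
  open import Data.Sum.Base using (_⊎_; inj₁; inj₂; [_,_]′)
  open import Function.Base using (_∘_)
  open import Relation.Binary.PropositionalEquality
  open import Relation.Nullary using (¬_; yes; no; does; contradiction)
  open import Relation.Nullary.Decidable using (decidable-stable; dec-true; dec-false)
  open import Defs
  open SquaresModulo

  -- The quadratic character written additively, except that multiples of n are
  -- sent to 1ℙ as well.
  opaque
    nonresidue : ℕ → ℤ → Parity
    nonresidue n a = if does (quadraticResidue? n a) then 0ℙ else 1ℙ

  -- The isomorphism of ℤ/2 onto the group of signs, leading from additive characters back to
  -- Legendre symbols.
  parityToℤ : Parity → ℤ
  parityToℤ 0ℙ = 1ℤ
  parityToℤ 1ℙ = -1ℤ

  opaque
    unfolding nonresidue

    residue⇒0ℙ : ∀ n a → QuadraticResidue n a → nonresidue n a ≡ 0ℙ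
    residue⇒0ℙ n a r = cong (if_then 0ℙ else 1ℙ) (dec-true (quadraticResidue? n a) r)

    ¬residue⇒1ℙ : ∀ n a → ¬ QuadraticResidue n a → nonresidue n a ≡ 1ℙ
    ¬residue⇒1ℙ n a ¬r = cong (if_then 0ℙ else 1ℙ) (dec-false (quadraticResidue? n a) ¬r)

    indicator-residue : ∀ n a → (if does (quadraticResidue? n a) then 1ℙ else 0ℙ) ≡ nonresidue n a ⁻¹
    indicator-residue n a = sym (if-float _⁻¹ (does (quadraticResidue? n a)))

    -- Excluding multiples of p removes the Legendre value 0, which no parity represents.
    legendre≡ : ∀ p a → ¬ + p ∣ a → legendre p a ≡ parityToℤ (nonresidue p a)
    legendre≡ p a p∤a = trans
      (cong (λ b → if b then 0ℤ else if does (quadraticResidue? p a) then 1ℤ else -1ℤ) (dec-false (+ p ∣? a) p∤a))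
      (sym (if-float parityToℤ (does (quadraticResidue? p a))))

  0ℙ⇒residue : ∀ n a → nonresidue n a ≡ 0ℙ → QuadraticResidue n a
  0ℙ⇒residue n a eq = decidable-stable (quadraticResidue? n a)
    λ ¬r → contradiction (trans (sym (¬residue⇒1ℙ n a ¬r)) eq) λ ()

  module Character {n : ℕ} (pn : Prime n) (n%4≡3 : n ℕ.% 4 ≡ 3) where
    open ThreeModFour pn n%4≡3

    residue-neg⇒1ℙ : ∀ a → QuadraticResidue n (- a) → nonresidue n a ≡ 1ℙ
    residue-neg⇒1ℙ a r = ¬residue⇒1ℙ n a (λ r′ → ¬residue×residue-neg a r′ r)

    -- Exactly one of a and -a is a square, as -1 is not one modulo n ≡ 3 (mod 4).
    nonresidue-neg : ∀ a → ¬ + n ∣ a → nonresidue n (- a) ≡ nonresidue n a ⁻¹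
    nonresidue-neg a n∤a = [
      (λ r → trans (¬residue⇒1ℙ n (- a) (¬residue×residue-neg a r)) (cong _⁻¹ (sym (residue⇒0ℙ n a r)))) ,
      (λ r → trans (residue⇒0ℙ n (- a) r) (cong _⁻¹ (sym (residue-neg⇒1ℙ a r)))) ]′
      (residue⊎residue-neg a n∤a)

    -- Up to sign both factors are squares, hence so is their product, and the signs multiply. This
    -- replaces the usual count of the index of the subgroup of squares.
    nonresidue-* : ∀ a b → ¬ + n ∣ a → ¬ + n ∣ b →
                   nonresidue n (a * b) ≡ nonresidue n a ℙ.+ nonresidue n b
    nonresidue-* a b n∤a n∤b = cases (residue⊎residue-neg a n∤a) (residue⊎residue-neg b n∤b)
      where
      QR = QuadraticResidue n
      identity : ∀ a b → - a * - b ≡ a * b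
      identity = solve-∀
      cases : QR a ⊎ QR (- a) → QR b ⊎ QR (- b) → nonresidue n (a * b) ≡ nonresidue n a ℙ.+ nonresidue n b
      cases (inj₁ r) (inj₁ s) = trans
        (residue⇒0ℙ n (a * b) (residue-* pn r s))
        (sym (cong₂ ℙ._+_ (residue⇒0ℙ n a r) (residue⇒0ℙ n b s)))
      cases (inj₁ r) (inj₂ s) = trans
        (residue-neg⇒1ℙ (a * b) (subst QR (sym (neg-distribʳ-* a b)) (residue-* pn r s)))
        (sym (cong₂ ℙ._+_ (residue⇒0ℙ n a r) (residue-neg⇒1ℙ b s)))
      cases (inj₂ r) (inj₁ s) = trans
        (residue-neg⇒1ℙ (a * b) (subst QR (sym (neg-distribˡ-* a b)) (residue-* pn r s)))
        (sym (cong₂ ℙ._+_ (residue-neg⇒1ℙ a r) (residue⇒0ℙ n b s)))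
      cases (inj₂ r) (inj₂ s) = trans
        (residue⇒0ℙ n (a * b) (subst QR (identity a b) (residue-* pn r s)))
        (sym (cong₂ ℙ._+_ (residue-neg⇒1ℙ a r) (residue-neg⇒1ℙ b s)))

    nonresidue-cong : ∀ a b → + n ∣ a - b → nonresidue n a ≡ nonresidue n b
    nonresidue-cong a b n∣a-b with quadraticResidue? n b
    ... | yes r = trans (residue⇒0ℙ n a (residue-cong (∣-sym a b n∣a-b) r)) (sym (residue⇒0ℙ n b r))
    ... | no ¬r = trans (¬residue⇒1ℙ n a (¬r ∘ residue-cong n∣a-b)) (sym (¬residue⇒1ℙ n b ¬r))

    nonresidue-1 : nonresidue n 1ℤ ≡ 0ℙ
    nonresidue-1 = residue⇒0ℙ n 1ℤ (residue-1 pn)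

    nonresidue-∸ : ∀ i j → i ℕ.+ j ≡ n → ¬ + n ∣ + i → nonresidue n (+ j) ≡ nonresidue n (+ i) ⁻¹
    nonresidue-∸ i j i+j≡n n∤i = trans (nonresidue-cong (+ j) (- + i) (divides 1ℤ j--i≡n)) (nonresidue-neg (+ i) n∤i)
      where
      identity : ∀ i j → j - - i ≡ 1ℤ * (i + j)
      identity = solve-∀
      j--i≡n : + j - - (+ i) ≡ 1ℤ * + n
      j--i≡n = trans (identity (+ i) (+ j)) (cong (λ k → 1ℤ * + k) i+j≡n)

    ∤-product : ∀ {xs} → All (λ x → ¬ + n ∣ + x) xs → ¬ + n ∣ + product xs
    ∤-product []           = proj₁ (residue-1 pn)
    ∤-product {x ∷ xs} (n∤x ∷ n∤xs) = ∤-* pn n∤x (∤-product n∤xs) ∘ subst (+ n ∣_) (pos-* x (product xs))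

    nonresidue-product : ∀ {xs} → All (λ x → ¬ + n ∣ + x) xs →
      nonresidue n (+ product xs) ≡ foldr (λ x → nonresidue n (+ x) ℙ.+_) 0ℙ xs
    nonresidue-product [] = nonresidue-1
    nonresidue-product {x ∷ xs} (n∤x ∷ n∤xs) = trans (cong (nonresidue n) (pos-* x (product xs)))
      (trans (nonresidue-* (+ x) (+ product xs) n∤x (∤-product n∤xs)) (cong (nonresidue n (+ x) ℙ.+_) (nonresidue-product n∤xs)))

-- Finite sums in ℤ/2: reflection, telescoping and sums over lists.

module ParitySums where
  open import Data.Bool.Base using (if_then_else_; true; false)
  open import Data.List.Base using (List; []; _∷_; _∷ʳ_; _++_; foldr; map; upTo; filter)
  open import Data.List.Properties using (upTo-∷ʳ; map-++)
  open import Data.Maybe.Base using (just; nothing)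
  open import Data.Nat.Base as ℕ using (ℕ; zero; suc; _∸_; parity)
  open import Data.Nat.DivMod using (_%_)
  open import Data.Nat.ListAction using (sum)
  import Data.Nat.Properties as ℕ
  open import Data.Parity.Base
  open import Data.Parity.Properties
  open import Function.Base using (_∘_)
  open import Level using (0ℓ)
  open import Relation.Binary.PropositionalEquality
  open import Relation.Nullary using (Dec; does)
  open import Relation.Unary using (Pred; Decidable)
  open import Tactic.RingSolver using (solve-∀)
  open import Tactic.RingSolver.Core.AlmostCommutativeRing using (AlmostCommutativeRing; fromCommutativeRing)
  open import Defs

  -- In Data.Parity, _+_ and _*_ have the same precedence, hence the brackets
  -- below.
  ℙ-ring : AlmostCommutativeRing 0ℓ 0ℓ
  ℙ-ring = fromCommutativeRing +-*-commutativeRing λ { 0ℙ → just refl ; 1ℙ → nothing }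

  -- f 1 + … + f n, without f 0.
  ∑ : (ℕ → Parity) → ℕ → Parity
  ∑ f zero    = 0ℙ
  ∑ f (suc n) = ∑ f n + f (suc n)

  ∑-cong : ∀ {f g} n → (∀ k → k ℕ.< n → f (suc k) ≡ g (suc k)) → ∑ f n ≡ ∑ g n
  ∑-cong zero    f≡g = refl
  ∑-cong (suc n) f≡g = cong₂ _+_ (∑-cong n (λ k k<n → f≡g k (ℕ.m<n⇒m<1+n k<n))) (f≡g n ℕ.≤-refl)

  ∑-+ : ∀ f g n → ∑ (λ k → f k + g k) n ≡ ∑ f n + ∑ g n
  ∑-+ f g zero    = refl
  ∑-+ f g (suc n) = trans (cong (_+ (f (suc n) + g (suc n))) (∑-+ f g n))
    (identity (∑ f n) (∑ g n) (f (suc n)) (g (suc n)))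
    where
    identity : ∀ a b c d → (a + b) + (c + d) ≡ (a + c) + (b + d)
    identity = solve-∀ ℙ-ring

  parity-suc : ∀ n → parity (suc n) ≡ parity n + 1ℙ
  parity-suc n = trans (+-homo-+ 1 n) (+-comm 1ℙ (parity n))

  ∑-const-1ℙ : ∀ n → ∑ (λ _ → 1ℙ) n ≡ parity n
  ∑-const-1ℙ zero    = refl
  ∑-const-1ℙ (suc n) = trans (cong (_+ 1ℙ) (∑-const-1ℙ n)) (sym (parity-suc n))

  -- The triangular number of 2t + 1 is (2t + 1)(t + 1), of the same parity as t + 1. For q = 4t + 3
  -- the latter is (q + 1)/4.
  ∑-parity : ∀ t → ∑ parity (suc (t ℕ.* 2)) ≡ parity (suc t)
  ∑-parity zero    = refl
  ∑-parity (suc t) = begin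
    (∑ parity (suc (t ℕ.* 2)) + parity (t ℕ.* 2)) + parity (suc (t ℕ.* 2))
      ≡⟨ cong₂ (λ x y → (x + parity (t ℕ.* 2)) + y) (∑-parity t) (parity-suc (t ℕ.* 2)) ⟩
    (parity (suc t) + parity (t ℕ.* 2)) + (parity (t ℕ.* 2) + 1ℙ) ≡⟨ identity (parity (suc t)) (parity (t ℕ.* 2)) ⟩
    parity (suc t) + 1ℙ                                           ≡⟨ parity-suc (suc t) ⟨
    parity (suc (suc t))                                          ∎
    where
    open ≡-Reasoning
    identity : ∀ a b → (a + b) + (b + 1ℙ) ≡ a + 1ℙ
    identity = solve-∀ ℙ-ring

  -- In ℤ/2 each of the last r terms, f (t + 1 - j) with 1 ≤ j ≤ r, equals f j + e j. The cut is
  -- left variable: the middle cut gives `∑-fold`, a general one the reflection of factorials.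
  ∑-reflect : ∀ f e t → (∀ j k → suc j ℕ.+ suc k ≡ suc t → f (suc j) + f (suc k) ≡ e (suc j)) →
    ∀ r s → r ℕ.+ s ≡ t → ∑ f t ≡ ∑ f s + (∑ f r + ∑ e r)
  ∑-reflect f e t f+f≡e zero    s refl = sym (+-identityʳ (∑ f s))
  ∑-reflect f e t f+f≡e (suc r) s r+s≡t = begin
    ∑ f t
      ≡⟨ ∑-reflect f e t f+f≡e r (suc s) (trans (ℕ.+-suc r s) r+s≡t) ⟩
    (∑ f s + f (suc s)) + (∑ f r + ∑ e r)
      ≡⟨ identity (∑ f s) (∑ f r) (∑ e r) (f (suc r)) (f (suc s)) ⟩
    ∑ f s + ((∑ f r + f (suc r)) + (∑ e r + (f (suc r) + f (suc s))))
      ≡⟨ cong (λ x → ∑ f s + ((∑ f r + f (suc r)) + (∑ e r + x))) (f+f≡e r s (cong suc (trans (ℕ.+-suc r s) r+s≡t))) ⟩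
    ∑ f s + ((∑ f r + f (suc r)) + (∑ e r + e (suc r)))
      ∎
    where
    open ≡-Reasoning
    identity : ∀ S R E a b → (S + b) + (R + E) ≡ S + ((R + a) + (E + (a + b)))
    identity = solve-∀ ℙ-ring

  -- Reflection at the middle, where the two copies of `∑ f m` cancel.
  ∑-fold : ∀ f e m → (∀ j k → suc j ℕ.+ suc k ≡ suc (m ℕ.+ m) → f (suc j) + f (suc k) ≡ e (suc j)) →
    ∑ f (m ℕ.+ m) ≡ ∑ e m
  ∑-fold f e m f+f≡e = trans (∑-reflect f e (m ℕ.+ m) f+f≡e m m refl) (identity (∑ f m) (∑ e m))
    where
    identity : ∀ a b → a + (a + b) ≡ b
    identity = solve-∀ ℙ-ring

  -- The pairs {k - 1, k} with k odd tile 0, 1, 2, ..., so the increments add up to the sum of all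
  -- values, where f 0 contributes nothing. For even n the last value f n has no partner, and the
  -- correction term removes it.
  ∑-odd-increments : ∀ f → f 0 ≡ 0ℙ → ∀ n →
    ∑ (λ k → parity k * (f k + f (k ∸ 1))) n ≡ ∑ f n + (parity (suc n) * f n)
  ∑-odd-increments f f0≡0 zero    = sym f0≡0
  ∑-odd-increments f f0≡0 (suc n) = begin
    ∑ g n + (parity (suc n) * (f (suc n) + f n))
      ≡⟨ cong (_+ (parity (suc n) * (f (suc n) + f n))) (∑-odd-increments f f0≡0 n) ⟩
    (∑ f n + (parity (suc n) * f n)) + (parity (suc n) * (f (suc n) + f n))
      ≡⟨ identity (∑ f n) (parity (suc n)) (f n) (f (suc n)) ⟩
    (∑ f n + f (suc n)) + ((parity (suc n) + 1ℙ) * f (suc n))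
      ≡⟨ cong (λ x → (∑ f n + f (suc n)) + (x * f (suc n))) (parity-suc (suc n)) ⟨
    (∑ f n + f (suc n)) + (parity (suc (suc n)) * f (suc n))
      ∎
    where
    open ≡-Reasoning
    g : ℕ → Parity
    g k = parity k * (f k + f (k ∸ 1))
    identity : ∀ S x a b → (S + (x * a)) + (x * (b + a)) ≡ (S + b) + ((x + 1ℙ) * b)
    identity = solve-∀ ℙ-ring

  indicator : ∀ {a} {A : Set a} → Dec A → Parity
  indicator A? = if does A? then 1ℙ else 0ℙ

  indicator-%2 : ∀ n → indicator (n % 2 ℕ.≟ 1) ≡ parity n
  indicator-%2 zero          = refl
  indicator-%2 (suc zero)    = refl
  indicator-%2 (suc (suc n)) = indicator-%2 n

  range-∷ʳ : ∀ n → [ 1 ⋯ suc n ] ≡ [ 1 ⋯ n ] ∷ʳ suc n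
  range-∷ʳ n = trans (cong (map suc) (sym (upTo-∷ʳ n))) (map-++ suc (upTo n) (n ∷ []))

  ∑ₗ : {A : Set} → (A → Parity) → List A → Parity
  ∑ₗ f = foldr (λ x → f x +_) 0ℙ

  ∑ₗ-++ : ∀ {A : Set} (f : A → Parity) xs ys → ∑ₗ f (xs ++ ys) ≡ ∑ₗ f xs + ∑ₗ f ys
  ∑ₗ-++ f []       ys = refl
  ∑ₗ-++ f (x ∷ xs) ys = trans (cong (f x +_) (∑ₗ-++ f xs ys)) (sym (+-assoc (f x) (∑ₗ f xs) (∑ₗ f ys)))

  ∑ₗ-map : ∀ {A B : Set} (f : B → Parity) (g : A → B) xs → ∑ₗ f (map g xs) ≡ ∑ₗ (f ∘ g) xs
  ∑ₗ-map f g []       = refl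
  ∑ₗ-map f g (x ∷ xs) = cong (f (g x) +_) (∑ₗ-map f g xs)

  ∑ₗ-filter : ∀ {P : Pred ℕ 0ℓ} (P? : Decidable P) f xs →
    ∑ₗ f (filter P? xs) ≡ ∑ₗ (λ k → indicator (P? k) * f k) xs
  ∑ₗ-filter P? f [] = refl
  ∑ₗ-filter P? f (x ∷ xs) with does (P? x)
  ... | false = ∑ₗ-filter P? f xs
  ... | true  = cong (f x +_) (∑ₗ-filter P? f xs)

  ∑ₗ-range : ∀ f n → ∑ₗ f [ 1 ⋯ n ] ≡ ∑ f n
  ∑ₗ-range f zero    = refl
  ∑ₗ-range f (suc n) = begin
    ∑ₗ f [ 1 ⋯ suc n ]                   ≡⟨ cong (∑ₗ f) (range-∷ʳ n) ⟩
    ∑ₗ f ([ 1 ⋯ n ] ∷ʳ suc n)            ≡⟨ ∑ₗ-++ f [ 1 ⋯ n ] (suc n ∷ []) ⟩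
    ∑ₗ f [ 1 ⋯ n ] + (f (suc n) + 0ℙ)    ≡⟨ cong₂ _+_ (∑ₗ-range f n) (+-identityʳ (f (suc n))) ⟩
    ∑ f (suc n)                          ∎
    where open ≡-Reasoning

  parity-sum : ∀ xs → parity (sum xs) ≡ ∑ₗ parity xs
  parity-sum []       = refl
  parity-sum (x ∷ xs) = trans (+-homo-+ x (sum xs)) (cong (parity x +_) (parity-sum xs))

  -- Under i ↦ 2 m + 1 - i the weight σ and the summands parity and Γ all change
  -- by 1ℙ, so parity i + Γ i is symmetric and σ picks one i of each pair.
  ∑-pairing : ∀ (σ Γ : ℕ → Parity) m →
    (∀ j k → suc j ℕ.+ suc k ≡ suc (m ℕ.+ m) → σ (suc k) ≡ σ (suc j) + 1ℙ) →
    (∀ j k → suc j ℕ.+ suc k ≡ suc (m ℕ.+ m) → Γ (suc k) ≡ Γ (suc j) + 1ℙ) →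
    ∑ (λ i → σ i * parity i) (m ℕ.+ m) + ∑ (λ i → σ i * Γ i) (m ℕ.+ m) ≡ ∑ parity m + ∑ Γ m
  ∑-pairing σ Γ m σ-flip Γ-flip = begin
    ∑ (λ i → σ i * parity i) (m ℕ.+ m) + ∑ (λ i → σ i * Γ i) (m ℕ.+ m)
      ≡⟨ ∑-+ (λ i → σ i * parity i) (λ i → σ i * Γ i) (m ℕ.+ m) ⟨
    ∑ f (m ℕ.+ m)                 ≡⟨ ∑-fold f (λ i → parity i + Γ i) m pair ⟩
    ∑ (λ i → parity i + Γ i) m    ≡⟨ ∑-+ parity Γ m ⟩
    ∑ parity m + ∑ Γ m            ∎
    where
    open ≡-Reasoning
    f : ℕ → Parity
    f i = (σ i * parity i) + (σ i * Γ i)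
    parity-flip : ∀ j k → suc j ℕ.+ suc k ≡ suc (m ℕ.+ m) → parity (suc k) ≡ parity (suc j) + 1ℙ
    parity-flip j k eq = trans (identity (parity (suc j)) (parity (suc k)))
      (cong (λ x → parity (suc j) + x) (trans (sym (+-homo-+ (suc j) (suc k))) (trans (cong parity eq)
        (trans (parity-suc (m ℕ.+ m)) (cong (_+ 1ℙ) (trans (+-homo-+ m m) (p+p≡0ℙ (parity m))))))))
      where
      identity : ∀ a b → b ≡ a + (a + b)
      identity = solve-∀ ℙ-ring
    pair : ∀ j k → suc j ℕ.+ suc k ≡ suc (m ℕ.+ m) → f (suc j) + f (suc k) ≡ parity (suc j) + Γ (suc j)
    pair j k eq rewrite σ-flip j k eq | Γ-flip j k eq | parity-flip j k eq =
      identity (σ (suc j)) (parity (suc j)) (Γ (suc j))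
      where
      identity : ∀ s a b → ((s * a) + (s * b)) + (((s + 1ℙ) * (a + 1ℙ)) + ((s + 1ℙ) * (b + 1ℙ))) ≡ a + b
      identity = solve-∀ ℙ-ring

  parity-1+n+n : ∀ n → parity (suc (n ℕ.+ n)) ≡ 1ℙ
  parity-1+n+n n = trans (parity-suc (n ℕ.+ n)) (cong (_+ 1ℙ) (trans (+-homo-+ n n) (p+p≡0ℙ (parity n))))

  parity-1+n*2 : ∀ n → parity (suc (n ℕ.* 2)) ≡ 1ℙ
  parity-1+n*2 n = trans (parity-suc (n ℕ.* 2)) (cong (_+ 1ℙ) (trans (*-homo-* n 2) (*-zeroʳ (parity n))))

-- Characters of factorials and of block products.

module FactorialBlocks where
  open import Data.Integer.Base as ℤ using (ℤ; +_; -1ℤ)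
  open import Data.Integer.Divisibility.Signed
  import Data.Integer.Properties as ℤ
  open import Data.List.Base using (map; upTo; []; _∷_; _++_)
  open import Data.List.Properties using (upTo-∷ʳ; map-++)
  open import Data.List.Relation.Unary.All as All using (All)
  import Data.List.Relation.Unary.All.Properties as All
  open import Data.Nat.Base as ℕ using (ℕ; zero; suc; _∸_; _!; NonZero; parity)
  import Data.Nat.Divisibility as ℕ
  open import Data.Nat.DivMod using (_/_; _%_; m≡m%n+[m/n]*n; m*n/n≡m)
  open import Data.Nat.ListAction using (sum; product)
  open import Data.Nat.ListAction.Properties using (product-++)
  open import Data.Nat.Primality
  import Data.Nat.Properties as ℕ
  open import Data.Nat.Tactic.RingSolver using () renaming (solve-∀ to solve-∀ℕ)
  open import Data.Parity.Base
  open import Data.Parity.Properties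
  open import Function.Base using (_∘_; case_of_)
  open import Function.Bundles using (_⇔_; mk⇔; Equivalence)
  open import Relation.Binary.PropositionalEquality
  open import Relation.Nullary using (¬_; Dec)
  open import Tactic.RingSolver using (solve-∀)
  open import Defs
  open Fermat
  open SquaresModulo
  open QuadraticCharacter
  open ParitySums

  -- A block product as a quotient of factorials, free of division. The order `d + a` agrees with
  -- the unfolding of `suc k * N` to `N + k * N`, on which `Π*!≡!` relies.
  product-range-! : ∀ a d → product [ a ℕ.+ 1 ⋯ d ℕ.+ a ] ℕ.* a ! ≡ (d ℕ.+ a) !
  product-range-! a d = trans (cong (λ l → product (map (a ℕ.+ 1 ℕ.+_) (upTo l)) ℕ.* a !) (length d a)) (go d)
    where
    length : ∀ d a → suc (d ℕ.+ a) ∸ (a ℕ.+ 1) ≡ d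
    length d a = trans (cong (suc (d ℕ.+ a) ∸_) (ℕ.+-comm a 1)) (ℕ.m+n∸n≡m d a)
    identity : ∀ a d x y → (x ℕ.* ((a ℕ.+ 1 ℕ.+ d) ℕ.* 1)) ℕ.* y ≡ suc (d ℕ.+ a) ℕ.* (x ℕ.* y)
    identity = solve-∀ℕ
    go : ∀ d → product (map (a ℕ.+ 1 ℕ.+_) (upTo d)) ℕ.* a ! ≡ (d ℕ.+ a) !
    go zero    = ℕ.*-identityˡ (a !)
    go (suc d) = begin
      product (map s (upTo (suc d))) ℕ.* a !                  ≡⟨ cong (λ l → product (map s l) ℕ.* a !) (upTo-∷ʳ d) ⟨
      product (map s (upTo d ++ (d ∷ []))) ℕ.* a !            ≡⟨ cong (λ l → product l ℕ.* a !) (map-++ s (upTo d) (d ∷ [])) ⟩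
      product (map s (upTo d) ++ (s d ∷ [])) ℕ.* a !          ≡⟨ cong (ℕ._* a !) (product-++ (map s (upTo d)) (s d ∷ [])) ⟩
      (product (map s (upTo d)) ℕ.* (s d ℕ.* 1)) ℕ.* a !      ≡⟨ identity a d (product (map s (upTo d))) (a !) ⟩
      suc (d ℕ.+ a) ℕ.* (product (map s (upTo d)) ℕ.* a !)    ≡⟨ cong (suc (d ℕ.+ a) ℕ.*_) (go d) ⟩
      suc (d ℕ.+ a) !                                         ∎
      where
      open ≡-Reasoning
      s = a ℕ.+ 1 ℕ.+_

  all-range : ∀ {P : ℕ → Set} n → (∀ k → k ℕ.< n → P (suc k)) → All P [ 1 ⋯ n ]
  all-range n P[1+k] = All.map⁺ (All.map (λ {k} → P[1+k] k) (All.all-upTo n))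

  -1^≡parityToℤ : ∀ k → -1ℤ ℤ.^ k ≡ parityToℤ (parity k)
  -1^≡parityToℤ zero    = refl
  -1^≡parityToℤ (suc k) = trans (cong (-1ℤ ℤ.*_) (-1^≡parityToℤ k)) (trans (neg (parity k)) (cong parityToℤ (sym (+-homo-+ 1 k))))
    where
    neg : ∀ x → -1ℤ ℤ.* parityToℤ x ≡ parityToℤ (x ⁻¹)
    neg 0ℙ = refl
    neg 1ℙ = refl

  -- In ℤ/2, A says y = z and l ≡ m says x = y. Equality of bits is their sum plus 1, so in the
  -- biconditional y cancels and x = z remains; the eight cases verify this.
  iff-from-sum : ∀ {A : Set} {l m n : ℤ} x y z →
    l ≡ parityToℤ x → m ≡ parityToℤ y → n ≡ parityToℤ z → A ⇔ y + z ≡ 0ℙ →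
    (A ⇔ l ≡ m) ⇔ l ≡ n
  iff-from-sum 0ℙ 0ℙ 0ℙ refl refl refl A⇔ = mk⇔ (λ _ → refl) (λ _ → mk⇔ (λ _ → refl) (λ _ → Equivalence.from A⇔ refl))
  iff-from-sum 1ℙ 1ℙ 1ℙ refl refl refl A⇔ = mk⇔ (λ _ → refl) (λ _ → mk⇔ (λ _ → refl) (λ _ → Equivalence.from A⇔ refl))
  iff-from-sum 0ℙ 1ℙ 0ℙ refl refl refl A⇔ = mk⇔ (λ _ → refl) (λ _ → mk⇔ (λ a → case Equivalence.to A⇔ a of λ ()) (λ ()))
  iff-from-sum 1ℙ 0ℙ 1ℙ refl refl refl A⇔ = mk⇔ (λ _ → refl) (λ _ → mk⇔ (λ a → case Equivalence.to A⇔ a of λ ()) (λ ()))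
  iff-from-sum 0ℙ 0ℙ 1ℙ refl refl refl A⇔ = mk⇔ (λ f → case Equivalence.to A⇔ (Equivalence.from f refl) of λ ()) (λ ())
  iff-from-sum 1ℙ 1ℙ 0ℙ refl refl refl A⇔ = mk⇔ (λ f → case Equivalence.to A⇔ (Equivalence.from f refl) of λ ()) (λ ())
  iff-from-sum 0ℙ 1ℙ 1ℙ refl refl refl A⇔ = mk⇔ (λ f → case Equivalence.to f (Equivalence.from A⇔ refl) of λ ()) (λ ())
  iff-from-sum 1ℙ 0ℙ 0ℙ refl refl refl A⇔ = mk⇔ (λ f → case Equivalence.to f (Equivalence.from A⇔ refl) of λ ()) (λ ())

  -1^suc : ∀ k a → -1ℤ ℤ.^ suc k ℤ.* a ≡ ℤ.- (-1ℤ ℤ.^ k ℤ.* a)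
  -1^suc k a = trans (ℤ.*-assoc -1ℤ (-1ℤ ℤ.^ k) a) (ℤ.-1*i≡-i (-1ℤ ℤ.^ k ℤ.* a))

  -- Factorials modulo a prime congruent to 3 modulo 4.

  module Factorials {n : ℕ} (pn : Prime n) (n%4≡3 : n % 4 ≡ 3) where
    open ThreeModFour pn n%4≡3
    open Character pn n%4≡3

    ν : ℕ → Parity
    ν j = nonresidue n (+ j)

    ∤small : ∀ {k} → suc k ℕ.< n → ¬ + n ∣ + suc k
    ∤small k<n n∣ = ℕ.<⇒≱ k<n (ℕ.∣⇒≤ (∣⇒∣ᵤ n∣))

    ∤! : ∀ {r} → r ℕ.< n → ¬ + n ∣ + (r !)
    ∤! r<n n∣ = prime∤! pn r<n (∣⇒∣ᵤ n∣)

    nonresidue-! : ∀ r → r ℕ.< n → ν (r !) ≡ ∑ ν r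
    nonresidue-! zero    _   = nonresidue-1
    nonresidue-! (suc r) r<n = begin
      nonresidue n (+ (suc r ℕ.* r !))       ≡⟨ cong (nonresidue n) (ℤ.pos-* (suc r) (r !)) ⟩
      nonresidue n (+ suc r ℤ.* + (r !))     ≡⟨ nonresidue-* (+ suc r) (+ (r !)) (∤small r<n) (∤! r<n′) ⟩
      ν (suc r) + ν (r !)                    ≡⟨ +-comm (ν (suc r)) (ν (r !)) ⟩
      ν (r !) + ν (suc r)                    ≡⟨ cong (_+ ν (suc r)) (nonresidue-! r r<n′) ⟩
      ∑ ν r + ν (suc r)                      ∎
      where
      open ≡-Reasoning
      r<n′ = ℕ.<-trans (ℕ.n<1+n r) r<n

    nonresidue-flip : ∀ j k → suc j ℕ.+ suc k ≡ n → ν (suc k) ≡ ν (suc j) + 1ℙ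
    nonresidue-flip j k eq = trans
      (nonresidue-∸ (suc j) (suc k) eq (∤small (subst (suc j ℕ.<_) eq (ℕ.m<m+n (suc j) (ℕ.s≤s ℕ.z≤n)))))
      (+-comm 1ℙ (ν (suc j)))

    -- Each reflected term n - j differs from j in character by 1ℙ, and r such differences add up to
    -- the parity of r.
    ∑ν-reflect : ∀ r s → r ℕ.+ s ≡ m ℕ.+ m → ∑ ν (m ℕ.+ m) ≡ ∑ ν s + (∑ ν r + parity r)
    ∑ν-reflect r s eq = trans (∑-reflect ν (λ _ → 1ℙ) (m ℕ.+ m) pair r s eq)
      (cong (λ x → ∑ ν s + (∑ ν r + x)) (∑-const-1ℙ r))
      where
      pair : ∀ j k → suc j ℕ.+ suc k ≡ suc (m ℕ.+ m) → ν (suc j) + ν (suc k) ≡ 1ℙ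
      pair j k eq = trans (cong (λ x → ν (suc j) + x) (nonresidue-flip j k (trans eq (sym n≡1+m+m)))) (identity (ν (suc j)))
        where
        identity : ∀ a → a + (a + 1ℙ) ≡ 1ℙ
        identity = solve-∀ ℙ-ring

    -- Each of the m pairs {j, n - j} contains one nonresidue, and m is odd. This is the character
    -- of (n - 1)!, in accordance with Wilson's theorem.
    ∑ν≡1ℙ : ∑ ν (m ℕ.+ m) ≡ 1ℙ
    ∑ν≡1ℙ = trans (∑ν-reflect m m refl) (trans (identity (∑ ν m) (parity m)) (parity-1+n*2 t))
      where
      identity : ∀ a b → a + (a + b) ≡ b
      identity = solve-∀ ℙ-ring

    -- The character of the congruence r! s! ≡ (-1)^(r + 1) for r + s = n - 1, which follows from
    -- Wilson's theorem by reflecting the factors of s!.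
    !-flip : ∀ r s → suc (r ℕ.+ s) ≡ n → ν (s !) ≡ (ν (r !) + parity r) + 1ℙ
    !-flip r s eq = begin
      ν (s !)                                      ≡⟨ nonresidue-! s (subst (s ℕ.<_) eq (ℕ.s≤s (ℕ.m≤n+m s r))) ⟩
      ∑ ν s                                        ≡⟨ identity (∑ ν s) (∑ ν r + parity r) ⟩
      (∑ ν r + parity r) + (∑ ν s + (∑ ν r + parity r))
        ≡⟨ cong (λ x → (∑ ν r + parity r) + x) (trans (sym (∑ν-reflect r s r+s≡m+m)) ∑ν≡1ℙ) ⟩
      (∑ ν r + parity r) + 1ℙ                      ≡⟨ cong (λ x → (x + parity r) + 1ℙ) (nonresidue-! r (subst (r ℕ.<_) eq (ℕ.s≤s (ℕ.m≤m+n r s)))) ⟨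
      (ν (r !) + parity r) + 1ℙ                    ∎
      where
      open ≡-Reasoning
      r+s≡m+m = ℕ.suc-injective (trans eq n≡1+m+m)
      identity : ∀ a b → a ≡ b + (a + b)
      identity = solve-∀ ℙ-ring

    -1^*-∤ : ∀ k a → ¬ + n ∣ a → ¬ + n ∣ -1ℤ ℤ.^ k ℤ.* a
    -1^*-∤ zero    a n∤a = n∤a ∘ subst (+ n ∣_) (ℤ.*-identityˡ a)
    -1^*-∤ (suc k) a n∤a = ∤-neg (-1^*-∤ k a n∤a) ∘ subst (+ n ∣_) (-1^suc k a)

    nonresidue-1^* : ∀ k a → ¬ + n ∣ a → nonresidue n (-1ℤ ℤ.^ k ℤ.* a) ≡ parity k + nonresidue n a
    nonresidue-1^* zero    a n∤a = cong (nonresidue n) (ℤ.*-identityˡ a)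
    nonresidue-1^* (suc k) a n∤a = begin
      nonresidue n (-1ℤ ℤ.^ suc k ℤ.* a)         ≡⟨ cong (nonresidue n) (-1^suc k a) ⟩
      nonresidue n (ℤ.- (-1ℤ ℤ.^ k ℤ.* a))       ≡⟨ nonresidue-neg (-1ℤ ℤ.^ k ℤ.* a) (-1^*-∤ k a n∤a) ⟩
      1ℙ + nonresidue n (-1ℤ ℤ.^ k ℤ.* a)        ≡⟨ cong _⁻¹ (nonresidue-1^* k a n∤a) ⟩
      1ℙ + (parity k + nonresidue n a)           ≡⟨ +-assoc 1ℙ (parity k) (nonresidue n a) ⟨
      (1ℙ + parity k) + nonresidue n a           ≡⟨ cong (_+ nonresidue n a) (+-homo-+ 1 k) ⟨
      parity (suc k) + nonresidue n a            ∎
      where open ≡-Reasoning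

  -- The q blocks of length N modulo p.

  module Blocks {p q : ℕ} .{{_ : NonZero q}} (pp : Prime p) (pq : Prime q)
    (q%4≡3 : q % 4 ≡ 3) (p%q≡1 : p % q ≡ 1) (p%4≡3 : p % 4 ≡ 3) where

    module P = ThreeModFour pp p%4≡3
    module Q = ThreeModFour pq q%4≡3
    module χₚ = Character pp p%4≡3
    module Fₚ = Factorials pp p%4≡3
    open Q using (t; m)

    N : ℕ
    N = (p ∸ 1) / q

    p≡1+qN : p ≡ suc (q ℕ.* N)
    p≡1+qN = trans p≡1+kq (cong suc (trans (ℕ.*-comm (p / q) q) (cong (q ℕ.*_) (sym N≡p/q))))
      where
      p≡1+kq : p ≡ suc (p / q ℕ.* q)
      p≡1+kq = trans (m≡m%n+[m/n]*n p q) (cong (ℕ._+ p / q ℕ.* q) p%q≡1)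
      N≡p/q : N ≡ p / q
      N≡p/q = trans (cong (λ r → (r ∸ 1) / q) p≡1+kq) (m*n/n≡m (p / q) q)

    -- The product q N = p - 1 is even while q is odd.
    parity-N : parity N ≡ 0ℙ
    parity-N = begin
      parity N                ≡⟨ cong (_* parity N) (trans (cong parity Q.n≡1+m+m) (parity-1+n+n m)) ⟨
      parity q * parity N     ≡⟨ *-homo-* q N ⟨
      parity (q ℕ.* N)        ≡⟨ cong parity (ℕ.suc-injective (trans (sym p≡1+qN) P.n≡1+m+m)) ⟩
      parity (P.m ℕ.+ P.m)    ≡⟨ +-homo-+ P.m P.m ⟩
      parity P.m + parity P.m ≡⟨ p+p≡0ℙ (parity P.m) ⟩
      0ℙ                      ∎
      where open ≡-Reasoning

    -- Since -1 is not a square modulo q, σ i is 1ℙ exactly when -i ∈ H.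
    Γ σ : ℕ → Parity
    Γ i = Fₚ.ν ((i ℕ.* N) !)
    σ i = nonresidue q (+ i)

    iN<p : ∀ {i} → i ℕ.≤ q → i ℕ.* N ℕ.< p
    iN<p {i} i≤q = subst (i ℕ.* N ℕ.<_) (sym p≡1+qN) (ℕ.s≤s (ℕ.*-monoˡ-≤ N i≤q))

    -- For indices i and q - i the arguments of the factorials add up to q N = p - 1, so `!-flip`
    -- applies; its term parity (i N) vanishes because N is even.
    Γ-flip : ∀ j k → suc j ℕ.+ suc k ≡ q → Γ (suc k) ≡ Γ (suc j) + 1ℙ
    Γ-flip j k eq = begin
      Γ (suc k)                                    ≡⟨ Fₚ.!-flip (suc j ℕ.* N) (suc k ℕ.* N) eq′ ⟩
      (Γ (suc j) + parity (suc j ℕ.* N)) + 1ℙ      ≡⟨ cong (λ x → (Γ (suc j) + x) + 1ℙ) parity-jN ⟩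
      (Γ (suc j) + 0ℙ) + 1ℙ                        ≡⟨ cong (_+ 1ℙ) (+-identityʳ (Γ (suc j))) ⟩
      Γ (suc j) + 1ℙ                               ∎
      where
      open ≡-Reasoning
      parity-jN : parity (suc j ℕ.* N) ≡ 0ℙ
      parity-jN = trans (*-homo-* (suc j) N) (trans (cong (parity (suc j) *_) parity-N) (*-zeroʳ (parity (suc j))))
      eq′ : suc (suc j ℕ.* N ℕ.+ suc k ℕ.* N) ≡ p
      eq′ = trans (cong suc (trans (sym (ℕ.*-distribʳ-+ N (suc j) (suc k))) (cong (ℕ._* N) eq))) (sym p≡1+qN)

    q∸1≡m+m : q ∸ 1 ≡ m ℕ.+ m
    q∸1≡m+m = cong (_∸ 1) Q.n≡1+m+m

    [q∸1]/2≡m : (q ∸ 1) / 2 ≡ m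
    [q∸1]/2≡m = trans (cong (_/ 2) (trans q∸1≡m+m (identity m))) (m*n/n≡m m 2)
      where
      identity : ∀ m → m ℕ.+ m ≡ m ℕ.* 2
      identity = solve-∀ℕ

    [q+1]/2≡1+m : (q ℕ.+ 1) / 2 ≡ suc m
    [q+1]/2≡1+m = trans (cong (_/ 2) (trans (cong (ℕ._+ 1) Q.n≡1+m+m) (identity m))) (m*n/n≡m (suc m) 2)
      where
      identity : ∀ m → suc (m ℕ.+ m) ℕ.+ 1 ≡ suc m ℕ.* 2
      identity = solve-∀ℕ

    [q+1]/4≡1+t : (q ℕ.+ 1) / 4 ≡ suc t
    [q+1]/4≡1+t = trans (cong (_/ 4) (trans (cong (ℕ._+ 1) Q.n≡1+m+m) (identity t))) (m*n/n≡m (suc t) 4)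
      where
      identity : ∀ t → suc (suc (t ℕ.* 2) ℕ.+ suc (t ℕ.* 2)) ℕ.+ 1 ≡ suc t ℕ.* 4
      identity = solve-∀ℕ

    Π*!≡! : ∀ k → Π[ p , q ] (suc k) ℕ.* (k ℕ.* N) ! ≡ (suc k ℕ.* N) !
    Π*!≡! k = product-range-! (k ℕ.* N) N

    p∤Π : ∀ k → suc k ℕ.≤ q → ¬ + p ∣ + Π[ p , q ] (suc k)
    p∤Π k k<q p∣Π = Fₚ.∤! (iN<p k<q) (subst (λ x → + p ∣ + x) (Π*!≡! k)
      (subst (+ p ∣_) (sym (ℤ.pos-* (Π[ p , q ] (suc k)) ((k ℕ.* N) !))) (∣m⇒∣m*n (+ ((k ℕ.* N) !)) p∣Π)))

    -- The block product is a quotient of two factorials prime to p, and in ℤ/2 the difference of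
    -- their characters is the sum.
    nonresidue-Π : ∀ k → suc k ℕ.≤ q → Fₚ.ν (Π[ p , q ] (suc k)) ≡ Γ (suc k) + Γ k
    nonresidue-Π k k<q = begin
      Fₚ.ν Πₖ                          ≡⟨ identity (Fₚ.ν Πₖ) (Γ k) ⟩
      (Fₚ.ν Πₖ + Γ k) + Γ k
        ≡⟨ cong (_+ Γ k) (χₚ.nonresidue-* (+ Πₖ) (+ ((k ℕ.* N) !)) (p∤Π k k<q) (Fₚ.∤! (iN<p (ℕ.<⇒≤ k<q)))) ⟨
      nonresidue p (+ Πₖ ℤ.* + ((k ℕ.* N) !)) + Γ k ≡⟨ cong (λ x → nonresidue p x + Γ k) (ℤ.pos-* Πₖ ((k ℕ.* N) !)) ⟨
      Fₚ.ν (Πₖ ℕ.* (k ℕ.* N) !) + Γ k  ≡⟨ cong (λ x → Fₚ.ν x + Γ k) (Π*!≡! k) ⟩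
      Γ (suc k) + Γ k                  ∎
      where
      open ≡-Reasoning
      Πₖ = Π[ p , q ] (suc k)
      identity : ∀ a b → a ≡ (a + b) + b
      identity = solve-∀ ℙ-ring

    -- Since (q + 1)/2 = m + 1 is even, an odd gap means an odd k. The increments of Γ over the odd
    -- k ≤ m then tile 0, ..., m.
    nonresidue-oddGapProduct :
      Fₚ.ν (product (map Π[ p , q ] (oddGapIndices q))) ≡ ∑ Γ m
    nonresidue-oddGapProduct = begin
      Fₚ.ν (product (map Π[ p , q ] (oddGapIndices q)))  ≡⟨ χₚ.nonresidue-product (All.map⁺ p∤Πs) ⟩
      ∑ₗ Fₚ.ν (map Π[ p , q ] (oddGapIndices q))         ≡⟨ ∑ₗ-map Fₚ.ν Π[ p , q ] (oddGapIndices q) ⟩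
      ∑ₗ (Fₚ.ν ∘ Π[ p , q ]) (oddGapIndices q)           ≡⟨ ∑ₗ-filter oddGap? (Fₚ.ν ∘ Π[ p , q ]) [ 1 ⋯ (q ∸ 1) / 2 ] ⟩
      ∑ₗ f [ 1 ⋯ (q ∸ 1) / 2 ]                           ≡⟨ ∑ₗ-range f ((q ∸ 1) / 2) ⟩
      ∑ f ((q ∸ 1) / 2)                                  ≡⟨ cong (∑ f) [q∸1]/2≡m ⟩
      ∑ f m                                              ≡⟨ ∑-cong m f≡ ⟩
      -- The value Γ 0 is the character of 0! = 1, hence 0ℙ.
      ∑ (λ k → parity k * (Γ k + Γ (k ∸ 1))) m           ≡⟨ ∑-odd-increments Γ χₚ.nonresidue-1 m ⟩
      ∑ Γ m + (parity (suc m) * Γ m)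
        -- As m is odd, the correction term has coefficient 0ℙ.
        ≡⟨ cong (λ x → ∑ Γ m + (x * Γ m)) (trans (parity-suc m) (cong (_+ 1ℙ) (parity-1+n*2 t))) ⟩
      ∑ Γ m + 0ℙ                                         ≡⟨ +-identityʳ (∑ Γ m) ⟩
      ∑ Γ m                                              ∎
      where
      open ≡-Reasoning
      oddGap? : ∀ k → Dec (((q ℕ.+ 1) / 2 ∸ k) % 2 ≡ 1)
      oddGap? k = ((q ℕ.+ 1) / 2 ∸ k) % 2 ℕ.≟ 1
      f : ℕ → Parity
      f k = indicator (oddGap? k) * Fₚ.ν (Π[ p , q ] k)
      m≤q : m ℕ.≤ q
      m≤q = subst (m ℕ.≤_) (sym Q.n≡1+m+m) (ℕ.m≤n⇒m≤1+n (ℕ.m≤m+n m m))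
      p∤Πs : All (λ k → ¬ + p ∣ + Π[ p , q ] k) (oddGapIndices q)
      p∤Πs = All.filter⁺ oddGap? (all-range ((q ∸ 1) / 2) (λ k k<m → p∤Π k (ℕ.≤-trans (subst (k ℕ.<_) [q∸1]/2≡m k<m) m≤q)))
      parity-gap : ∀ k → k ℕ.< m → parity (m ∸ k) ≡ parity (suc k)
      parity-gap k k<m = begin
        parity (m ∸ k)                        ≡⟨ identity (parity (m ∸ k)) (parity k) ⟩
        (parity (m ∸ k) + parity k) + parity k ≡⟨ cong (_+ parity k) (+-homo-+ (m ∸ k) k) ⟨
        parity (m ∸ k ℕ.+ k) + parity k       ≡⟨ cong (λ l → parity l + parity k) (ℕ.m∸n+n≡m (ℕ.<⇒≤ k<m)) ⟩
        parity m + parity k                   ≡⟨ cong (_+ parity k) (parity-1+n*2 t) ⟩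
        1ℙ + parity k                         ≡⟨ +-homo-+ 1 k ⟨
        parity (suc k)                        ∎
        where
        identity : ∀ a b → a ≡ (a + b) + b
        identity = solve-∀ ℙ-ring
      f≡ : ∀ k → k ℕ.< m → f (suc k) ≡ parity (suc k) * (Γ (suc k) + Γ k)
      f≡ k k<m = cong₂ _*_
        (trans (indicator-%2 ((q ℕ.+ 1) / 2 ∸ suc k)) (trans (cong (λ l → parity (l ∸ suc k)) [q+1]/2≡1+m) (parity-gap k k<m)))
        (nonresidue-Π k (ℕ.≤-trans k<m m≤q))

    -- Rewrites a sum over the i with -i ∈ H as a sum over all of 1, ..., q - 1 weighted by σ, the
    -- form on which the pairing of i with q - i acts.
    ∑ₗ-negSquares : ∀ f → ∑ₗ f (negSquares q) ≡ ∑ (λ i → σ i * f i) (m ℕ.+ m)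
    ∑ₗ-negSquares f = begin
      ∑ₗ f (negSquares q)                   ≡⟨ ∑ₗ-filter negSquare? f [ 1 ⋯ q ∸ 1 ] ⟩
      ∑ₗ g [ 1 ⋯ q ∸ 1 ]                    ≡⟨ ∑ₗ-range g (q ∸ 1) ⟩
      ∑ g (q ∸ 1)                           ≡⟨ cong (∑ g) q∸1≡m+m ⟩
      ∑ g (m ℕ.+ m)                         ≡⟨ ∑-cong (m ℕ.+ m) (λ i i<2m → cong (_* f (suc i)) (indicator-negSquare i i<2m)) ⟩
      ∑ (λ i → σ i * f i) (m ℕ.+ m)         ∎
      where
      open ≡-Reasoning
      negSquare? : ∀ i → Dec (QuadraticResidue q (ℤ.- (+ i)))
      negSquare? i = quadraticResidue? q (ℤ.- (+ i))
      g : ℕ → Parity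
      g i = indicator (negSquare? i) * f i
      indicator-negSquare : ∀ i → i ℕ.< m ℕ.+ m → indicator (negSquare? (suc i)) ≡ σ (suc i)
      indicator-negSquare i i<2m = begin
        indicator (negSquare? (suc i))          ≡⟨ indicator-residue q (ℤ.- (+ suc i)) ⟩
        nonresidue q (ℤ.- (+ suc i)) ⁻¹         ≡⟨ cong _⁻¹ (Character.nonresidue-neg pq q%4≡3 (+ suc i) q∤1+i) ⟩
        σ (suc i) ⁻¹ ⁻¹                         ≡⟨ ⁻¹-involutive (σ (suc i)) ⟩
        σ (suc i)                               ∎
        where
        q∤1+i : ¬ + q ∣ + suc i
        q∤1+i = Factorials.∤small pq q%4≡3 (subst (suc i ℕ.<_) (sym Q.n≡1+m+m) (ℕ.s≤s i<2m))

    p∤factorials : All (λ i → ¬ + p ∣ + ((i ℕ.* N) !)) (negSquares q)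
    p∤factorials = All.filter⁺ (λ i → quadraticResidue? q (ℤ.- (+ i)))
      (all-range (q ∸ 1) (λ i i<q∸1 → Fₚ.∤! (iN<p (ℕ.≤-trans i<q∸1 (ℕ.m∸n≤m q 1)))))

    factorials : ℕ
    factorials = product (map (λ i → (i ℕ.* N) !) (negSquares q))

    p∤factorialProduct : ¬ + p ∣ + factorials
    p∤factorialProduct = χₚ.∤-product (All.map⁺ p∤factorials)

    nonresidue-factorials : Fₚ.ν factorials ≡ ∑ (λ i → σ i * Γ i) (m ℕ.+ m)
    nonresidue-factorials = begin
      Fₚ.ν factorials                                        ≡⟨ χₚ.nonresidue-product (All.map⁺ p∤factorials) ⟩
      ∑ₗ Fₚ.ν (map (λ i → (i ℕ.* N) !) (negSquares q))       ≡⟨ ∑ₗ-map Fₚ.ν (λ i → (i ℕ.* N) !) (negSquares q) ⟩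
      ∑ₗ Γ (negSquares q)                                    ≡⟨ ∑ₗ-negSquares Γ ⟩
      ∑ (λ i → σ i * Γ i) (m ℕ.+ m)                          ∎
      where open ≡-Reasoning

    -- As q is odd, β and q β have the same parity.
    parity-β : ∀ β → q ℕ.* β ≡ sum (negSquares q) → parity β ≡ ∑ (λ i → σ i * parity i) (m ℕ.+ m)
    parity-β β qβ≡sum = begin
      parity β                  ≡⟨ cong (_* parity β) (trans (cong parity Q.n≡1+m+m) (parity-1+n+n m)) ⟨
      parity q * parity β       ≡⟨ *-homo-* q β ⟨
      parity (q ℕ.* β)          ≡⟨ cong parity qβ≡sum ⟩
      parity (sum (negSquares q)) ≡⟨ parity-sum (negSquares q) ⟩
      ∑ₗ parity (negSquares q)  ≡⟨ ∑ₗ-negSquares parity ⟩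
      ∑ (λ i → σ i * parity i) (m ℕ.+ m) ∎
      where open ≡-Reasoning

    -- By the pairing, the signed product of factorials has character `∑ parity m + ∑ Γ m`. Adding
    -- the parity of (q + 1)/4, which is `∑ parity m`, leaves `∑ Γ m`, the character of the block
    -- product.
    oddGapProduct≡factorials : ∀ β → q ℕ.* β ≡ sum (negSquares q) →
      Fₚ.ν (product (map Π[ p , q ] (oddGapIndices q))) ≡
      nonresidue p (-1ℤ ℤ.^ β ℤ.* + factorials) + parity ((q ℕ.+ 1) / 4)
    oddGapProduct≡factorials β qβ≡sum = begin
      Fₚ.ν (product (map Π[ p , q ] (oddGapIndices q)))  ≡⟨ nonresidue-oddGapProduct ⟩
      ∑ Γ m                                              ≡⟨ identity (∑ parity m) (∑ Γ m) ⟩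
      (∑ parity m + ∑ Γ m) + ∑ parity m                  ≡⟨ cong (_+ ∑ parity m) (∑-pairing σ Γ m σ-flip′ Γ-flip′) ⟨
      (∑ (λ i → σ i * parity i) (m ℕ.+ m) + ∑ (λ i → σ i * Γ i) (m ℕ.+ m)) + ∑ parity m
        ≡⟨ cong₂ (λ x y → (x + y) + ∑ parity m) (parity-β β qβ≡sum) nonresidue-factorials ⟨
      (parity β + Fₚ.ν factorials) + ∑ parity m
        ≡⟨ cong₂ _+_ (Fₚ.nonresidue-1^* β (+ factorials) p∤factorialProduct) (trans (cong parity [q+1]/4≡1+t) (sym (∑-parity t))) ⟨
      nonresidue p (-1ℤ ℤ.^ β ℤ.* + factorials) + parity ((q ℕ.+ 1) / 4) ∎
      where
      open ≡-Reasoning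
      identity : ∀ a b → b ≡ (a + b) + a
      identity = solve-∀ ℙ-ring
      σ-flip′ : ∀ j k → suc j ℕ.+ suc k ≡ suc (m ℕ.+ m) → σ (suc k) ≡ σ (suc j) + 1ℙ
      σ-flip′ j k eq = Factorials.nonresidue-flip pq q%4≡3 j k (trans eq (sym Q.n≡1+m+m))
      Γ-flip′ : ∀ j k → suc j ℕ.+ suc k ≡ suc (m ℕ.+ m) → Γ (suc k) ≡ Γ (suc j) + 1ℙ
      Γ-flip′ j k eq = Γ-flip j k (trans eq (sym Q.n≡1+m+m))

-- The equivalence, from the comparison of characters.

open import Data.Nat using (ℕ; _∸_; _!; NonZero) renaming (_+_ to _+ℕ_; _*_ to _*ℕ_)
open import Data.Nat.DivMod using (_/_; _%_)
open import Data.Nat.Primality using (Prime)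
open import Data.Integer using (ℤ; +_; -1ℤ; _+_; _-_; _*_; _^_)
open import Data.Integer.Divisibility.Signed using (_∣_)
open import Data.Nat.ListAction using (sum; product)
open import Data.List using (map)
open import Function.Bundles using (_⇔_; mk⇔)
open import Relation.Binary.PropositionalEquality using (_≡_; sym; trans)
open import Relation.Nullary using (¬_)
open import Defs

theorem2 : (p q : ℕ) .{{_ : NonZero q}} → Prime p → Prime q →
    q % 4 ≡ 3 → p % q ≡ 1 → p % 4 ≡ 3 →
    (β : ℕ) → q *ℕ β ≡ sum (negSquares q) →
    (h : ℕ) → IsClassNumber q h →
    (a b : ℤ) → + 4 * (+ p) ^ h ≡ a * a + + q * (b * b) → + q ∣ a - + 2 → ¬ (+ p ∣ a) →
    (QuadraticResidue p (+ product (map Π[ p , q ] (oddGapIndices q)))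
    ⇔ legendre p a ≡ legendre p (-1ℤ ^ β * + product (map (λ i → (i *ℕ ((p ∸ 1) / q)) !) (negSquares q))))
    ⇔ legendre p a ≡ -1ℤ ^ ((q +ℕ 1) / 4)
theorem2 p q pp pq q%4≡3 p%q≡1 p%4≡3 β qβ≡sum h _ a b _ _ p∤a =
  iff-from-sum (nonresidue p a) (nonresidue p F) (ℕ.parity ((q +ℕ 1) / 4))
    (legendre≡ p a p∤a)
    (legendre≡ p F (Fₚ.-1^*-∤ β (+ factorials) p∤factorialProduct))
    (-1^≡parityToℤ ((q +ℕ 1) / 4))
    -- The block product is a residue exactly when its character vanishes, and by `key` this
    -- character is that of F plus the parity of (q + 1)/4.
    (mk⇔ (λ r → trans (sym key) (residue⇒0ℙ p A r)) (λ e → 0ℙ⇒residue p A (trans key e)))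
  where
  open QuadraticCharacter
  open FactorialBlocks
  open Blocks pp pq q%4≡3 p%q≡1 p%4≡3
  import Data.Nat.Base as ℕ
  A F : ℤ
  A = + product (map Π[ p , q ] (oddGapIndices q))
  F = -1ℤ ^ β * + factorials
  key = oddGapProduct≡factorials β qβ≡sum
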